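{- If, in a metric space induced by a connected graph on $n$ vertices, no line consists of all $n$ vertices, then there are at least $2^{ -8/7}n^{2/7}$ distinct lines.
   Context: Every finite connected undirected graph induces a metric space $(X,d)$, where $X$ is the vertex set of the graph and the distance $d(u,v)$ between vertices $u$ and $v$ is the smallest number of edges in a path from $u$ to $v$. For points $a,b,c$ of a metric space $(X,d)$, write $[abc]$ if $a,b,c$ are three distinct points and $d(a,b)+d(b,c)=d(a,c)$. For any two distinct points $u,v\in X$, the line $\overline{uv}$ is the set $\{p:[puv]\}\cup\{u\}\cup\{p:[upv]\}\cup\{v\}\cup\{p:[uvp]\}$. The lines of $(X,d)$ are the sets $\overline{uv}$ with $u,v$ ranging over pairs of distinct points; distinct lines are counted as distinct subsets of $X$.
   Formalization: The formal theorem assumes n ≥ 2: for a graph on a single vertex there are no lines, so "no line consists of all n vertices" holds vacuously while the bound 0 ≥ 2^{ -8/7} fails. -}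

module Defs where

open import Data.Bool.Properties as Bool using ()
open import Data.Fin using (Fin; _≟_)
open import Data.Fin.Subset using (Subset; ⊤)
open import Data.List using (List; length; map; filter; deduplicate; cartesianProduct; allFin)
open import Data.Nat using (ℕ; zero; suc; _+_; _≤_; z≤n; s≤s)
open import Data.Nat.Properties as ℕ using ()
open import Data.Fin.Properties using (any?)
open import Data.Product using (∃; _×_; _,_; proj₁; uncurry)
open import Data.Sum using (_⊎_)
open import Data.Vec using (Vec; []; _∷_; head; last; tabulate)
open import Data.Vec.Properties using (≡-dec)
open import Data.Vec.Relation.Unary.Linked using (Linked; linked?)
open import Data.Vec.Relation.Unary.AllPairs using (allPairs?)
open import Data.Vec.Relation.Unary.Unique.Propositional using (Unique)
open import Function.Base using (_∘_)
open import Function.Metric.Nat using (DistanceFunction)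
open import Level using (0ℓ)
open import Relation.Binary using (Rel; Symmetric; Irreflexive; Decidable)
open import Relation.Binary.PropositionalEquality using (_≡_; _≢_)
open import Relation.Nullary using (Dec; does; yes; no; ¬?; contradiction; _×-dec_; _⊎-dec_)
open import Relation.Nullary.Decidable using (map′)
import Relation.Unary as U

private
  variable
    n : ℕ

record Graph (n : ℕ) : Set₁ where
  field
    Adj    : Rel (Fin n) 0ℓ
    adj?   : Decidable Adj
    symm   : Symmetric Adj
    irrefl : Irreflexive _≡_ Adj

-- A path with k edges is the vector of its k + 1 pairwise distinct vertices.
IsPath : Graph n → Fin n → Fin n → ∀ {k} → Vec (Fin n) (suc k) → Set
IsPath G u v p = head p ≡ u × last p ≡ v × Unique p × Linked (Graph.Adj G) p

HasPath : Graph n → Fin n → Fin n → ℕ → Set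
HasPath {n} G u v k = ∃ λ (p : Vec (Fin n) (suc k)) → IsPath G u v p

Connected : Graph n → Set
Connected G = ∀ u v → ∃ λ k → HasPath G u v k

anyVec? : ∀ {k} {P : Vec (Fin n) k → Set} → U.Decidable P → Dec (∃ P)
anyVec? {k = zero}  P? = map′ ([] ,_) (λ { ([] , p) → p }) (P? [])
anyVec? {k = suc k} P? =
  map′ (λ (x , xs , p) → (x ∷ xs , p)) (λ { (x ∷ xs , p) → (x , xs , p) })
       (any? λ x → anyVec? λ xs → P? (x ∷ xs))

hasPath? : (G : Graph n) (u v : Fin n) → U.Decidable (HasPath G u v)
hasPath? G u v k = anyVec? λ p →
  head p ≟ u ×-dec last p ≟ v ×-dec
  allPairs? (λ x y → ¬? (x ≟ y)) p ×-dec linked? (Graph.adj? G) p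

least : {P : ℕ → Set} → U.Decidable P → ∀ k → P k → ∃ λ m → P m × (∀ j → P j → m ≤ j)
least P? k pk with P? 0
least P? k       pk | yes p0 = 0 , p0 , λ _ _ → z≤n
least P? zero    p0 | no ¬p0 = contradiction p0 ¬p0
least P? (suc k) pk | no ¬p0 with least (P? ∘ suc) k pk
... | m , pm , min = suc m , pm , λ
  { zero    p0 → contradiction p0 ¬p0
  ; (suc j) pj → s≤s (min j pj)
  }

dist : (G : Graph n) → Connected G → DistanceFunction (Fin n)
dist G conn u v = proj₁ (uncurry (least (hasPath? G u v)) (conn u v))

module _ (d : DistanceFunction (Fin n)) where

  -- [abc]
  Between : Fin n → Fin n → Fin n → Set
  Between a b c = (a ≢ b × b ≢ c × a ≢ c) × d a b + d b c ≡ d a c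

  between? : ∀ a b c → Dec (Between a b c)
  between? a b c =
    (¬? (a ≟ b) ×-dec ¬? (b ≟ c) ×-dec ¬? (a ≟ c)) ×-dec d a b + d b c ℕ.≟ d a c

  OnLine : Fin n → Fin n → Fin n → Set
  OnLine u v p = Between p u v ⊎ p ≡ u ⊎ Between u p v ⊎ p ≡ v ⊎ Between u v p

  onLine? : ∀ u v → U.Decidable (OnLine u v)
  onLine? u v p =
    between? p u v ⊎-dec p ≟ u ⊎-dec between? u p v ⊎-dec p ≟ v ⊎-dec between? u v p

  -- Only meaningful for u ≢ v.
  line : Fin n → Fin n → Subset n
  line u v = tabulate (does ∘ onLine? u v)

  lines : List (Subset n)
  lines = deduplicate (≡-dec Bool._≟_)
    (map (uncurry line)
      (filter (λ (u , v) → ¬? (u ≟ v)) (cartesianProduct (allFin n) (allFin n))))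

  numberOfLines : ℕ
  numberOfLines = length lines

  NoUniversalLine : Set
  NoUniversalLine = ∀ u v → u ≢ v → line u v ≢ ⊤

{-# OPTIONS --safe #-}
module Submission where

-- Let m be the number of lines.
--
-- Let D be a distance, realised by a geodesic γ 0, …, γ D.  Suppose some edges
-- of γ span the same line; it misses a point w, so the distance from w does not
-- change along any of these edges.  Hence, if two of the edges start at γ i and
-- γ j and the lines w γ i and w γ j agree, then w lies between γ i and γ j; this
-- cannot happen for three edges at once.  So at most 2m edges span a given line,
-- and D ≤ 2m².
--
-- Now fix a point x.  Points y with the same line xy = L and the same distance
-- d x y = r are pairwise at distance 2r, so the lines spanned by two of them
-- contain no third one.  If there are at least 2t such points, then joining the
-- first t to the rest gives t² distinct lines, hence t² ≤ m.  With s = ⌊√m⌋ this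
-- yields n - 1 ≤ m (2m² + 1) (2s + 1) ≤ 9 s m³, so that n ≤ 10 s m³ and
-- n² ≤ 100 m⁷.

open import Defs
open import Data.Bool using (true; false)
import Data.Bool.Properties as Bool
open import Data.Empty using (⊥)
open import Data.Fin using (Fin; _≟_; fromℕ<; punchIn)
open import Data.Fin.Properties using (¬∀⟶∃¬; punchIn-injective; punchInᵢ≢i)
open import Data.Fin.Subset using (Subset; ⊤)
open import Data.List
  using (List; []; _∷_; length; filter; upTo; map; take; drop; cartesianProduct; tabulate)
open import Data.List.Membership.Propositional using (_∈_)
open import Data.List.Membership.Propositional.Properties
  using (∈-map⁺; ∈-filter⁺; ∈-filter⁻; ∈-deduplicate⁺; ∈-cartesianProduct⁺;
         ∈-cartesianProduct⁻; ∈-allFin; ∈-upTo⁺; ∈-upTo⁻)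
open import Data.List.Properties
  using (length-++; length-map; length-take; length-drop; length-upTo; length-tabulate)
open import Data.List.Relation.Binary.Sublist.Propositional.Properties
  using (filter-⊆; filter⁺; length-mono-≤)
open import Data.List.Relation.Unary.All as All using (All; []; _∷_)
import Data.List.Relation.Unary.All.Properties as All
open import Data.List.Relation.Unary.AllPairs as AllPairs using (AllPairs; []; _∷_)
import Data.List.Relation.Unary.AllPairs.Properties as AllPairs
open import Data.List.Relation.Unary.Any using (here; there)
import Data.List.Relation.Unary.Unique.Propositional as List using (Unique)
import Data.List.Relation.Unary.Unique.Propositional.Properties as Unique
open import Data.Nat using (ℕ; zero; suc; _+_; _∸_; _≤_; _<_; _*_; _^_; z≤n; s≤s)
import Data.Nat.Properties as ℕ using (_≟_)
open import Data.Nat.Properties hiding (_≟_)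
open import Data.Nat.Solver using (module +-*-Solver)
open import Data.Product using (∃; _×_; _,_; proj₁; proj₂; uncurry)
open import Data.Sum using (_⊎_; inj₁; inj₂; [_,_]′)
open import Data.Vec as Vec using (Vec; []; _∷_)
open import Data.Vec.Membership.DecPropositional using () renaming (_∈?_ to mem?)
open import Data.Vec.Membership.Propositional using () renaming (_∈_ to _∈ᵛ_)
import Data.Vec.Properties as Vec
import Data.Vec.Relation.Unary.All as Vec using (All; []; _∷_)
open import Data.Vec.Relation.Unary.AllPairs using ([]; _∷_)
open import Data.Vec.Relation.Unary.Any using (here; there)
open import Data.Vec.Relation.Unary.Linked using ([-]; _∷_)
open import Function.Base using (_∘_; id)
open import Function.Metric.Nat using (DistanceFunction; IsMetric)
open import Relation.Binary using (DecidableEquality)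
open import Relation.Binary.PropositionalEquality
open import Relation.Nullary using (¬_; yes; no; does; ¬?; proof; invert; Reflects; contradiction)
open import Relation.Nullary.Decidable using (dec-true)
open import Relation.Unary using (Pred; Decidable)

open +-*-Solver using (solve; con; _:+_; _:*_; _:^_; _:=_)

-- Counting in lists: fibres and pigeonholes.

_≟ᴸ_ : ∀ {n} → DecidableEquality (Subset n)
_≟ᴸ_ = Vec.≡-dec Bool._≟_

m+n≡m⇒n≡0 : ∀ m {n} → m + n ≡ m → n ≡ 0
m+n≡m⇒n≡0 m eq = +-cancelˡ-≡ m _ 0 (trans eq (sym (+-identityʳ m)))

length-filter-∁ : ∀ {a p} {A : Set a} {P : Pred A p} (P? : Decidable P) (xs : List A) →
  length xs ≡ length (filter P? xs) + length (filter (¬? ∘ P?) xs)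
length-filter-∁ P? [] = refl
length-filter-∁ P? (x ∷ xs) with ih ← length-filter-∁ P? xs | does (P? x)
... | true  = cong suc ih
... | false = trans (cong suc ih) (sym (+-suc _ _))

length-cartesianProduct : ∀ {a b} {A : Set a} {B : Set b} (xs : List A) (ys : List B) →
  length (cartesianProduct xs ys) ≡ length xs * length ys
length-cartesianProduct []       ys = refl
length-cartesianProduct (x ∷ xs) ys = trans
  (length-++ (map (x ,_) ys))
  (cong₂ _+_ (length-map _ ys) (length-cartesianProduct xs ys))

module _ {a c} {A : Set a} {C : Set c} (_≟ᶜ_ : DecidableEquality C) (f : A → C) where

  fibre : C → List A → List A
  fibre c = filter (λ x → f x ≟ᶜ c)

  -- Pigeonhole by induction on `cs`: removing the fibre over `c` leaves values in the remaining
  -- list, and the fibres of what is left are sublists of the old ones.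
  length≤∑fibres : ∀ {k} cs xs → All (λ x → f x ∈ cs) xs →
    (∀ c → length (fibre c xs) ≤ k) → length xs ≤ length cs * k
  length≤∑fibres _        []       _         _     = z≤n
  length≤∑fibres []       (_ ∷ _)  (() ∷ _)
  length≤∑fibres {k} (c ∷ cs) xs@(_ ∷ _) fxs∈ small = begin
    length xs
      ≡⟨ length-filter-∁ c? xs ⟩
    length (fibre c xs) + length others
      ≤⟨ +-mono-≤ (small c) (length≤∑fibres cs others others∈ others-small) ⟩
    k + length cs * k
      ∎
    where
    open ≤-Reasoning
    c? : Decidable (λ x → f x ≡ c)
    c? x = f x ≟ᶜ c
    others : List A
    others = filter (¬? ∘ c?) xs
    others∈ : All (λ x → f x ∈ cs) others
    others∈ = All.zipWith
      (λ { (fx≢c , here fx≡c) → contradiction fx≡c fx≢c ; (_ , there fx∈cs) → fx∈cs })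
      (All.all-filter (¬? ∘ c?) xs , All.filter⁺ (¬? ∘ c?) fxs∈)
    others-small : ∀ c′ → length (fibre c′ others) ≤ k
    others-small c′ = ≤-trans
      (length-mono-≤ (filter⁺ (λ x → f x ≟ᶜ c′) (λ x → f x ≟ᶜ c′)
        (λ { refl p → p }) (filter-⊆ (¬? ∘ c?) xs)))
      (small c′)

module _ {a c} {A : Set a} {C : Set c} (_≟ᶜ_ : DecidableEquality C) (f : A → C) where

  injective⇒length≤ : ∀ cs {xs} → List.Unique xs → All (λ x → f x ∈ cs) xs →
    (∀ {x y} → x ∈ xs → y ∈ xs → f x ≡ f y → x ≡ y) → length xs ≤ length cs
  injective⇒length≤ cs {xs} xs! fxs∈ inj = ≤-trans
    (length≤∑fibres _≟ᶜ_ f cs xs fxs∈ small) (≤-reflexive (*-identityʳ _))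
    where
    ≤1 : ∀ {c} ys → List.Unique ys → (∀ {y} → y ∈ ys → y ∈ xs × f y ≡ c) → length ys ≤ 1
    ≤1 []          _  _ = z≤n
    ≤1 (_ ∷ [])    _  _ = ≤-refl
    ≤1 (y ∷ z ∷ _) ((y≢z ∷ _) ∷ _) ys∈ =
      let y∈xs , fy≡c = ys∈ (here refl)
          z∈xs , fz≡c = ys∈ (there (here refl))
      in  contradiction (inj y∈xs z∈xs (trans fy≡c (sym fz≡c))) y≢z
    small : ∀ c → length (fibre _≟ᶜ_ f c xs) ≤ 1
    small c = ≤1 _ (AllPairs.filter⁺ (λ x → f x ≟ᶜ c) xs!) (∈-filter⁻ (λ x → f x ≟ᶜ c))

no-triple⇒length≤2 : ∀ {a r} {A : Set a} {R : A → A → Set r} xs → AllPairs R xs →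
  (∀ {x y z} → x ∈ xs → y ∈ xs → z ∈ xs → R x y → R y z → ⊥) → length xs ≤ 2
no-triple⇒length≤2 []          _ _ = z≤n
no-triple⇒length≤2 (_ ∷ [])    _ _ = s≤s z≤n
no-triple⇒length≤2 (_ ∷ _ ∷ []) _ _ = ≤-refl
no-triple⇒length≤2 (_ ∷ _ ∷ _ ∷ _) ((x~y ∷ _) ∷ (y~z ∷ _) ∷ _) no-triple =
  contradiction y~z (no-triple (here refl) (there (here refl)) (there (there (here refl))) x~y)

AllPairs-take-drop : ∀ {a r} {A : Set a} {R : A → A → Set r} t {xs x y} → AllPairs R xs →
  x ∈ take t xs → y ∈ drop t xs → R x y
AllPairs-take-drop zero    _         ()
AllPairs-take-drop (suc t) (r ∷ _)   (here refl) y∈ = All.lookup (All.drop⁺ t r) y∈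
AllPairs-take-drop (suc t) (_ ∷ rs)  (there x∈)  y∈ = AllPairs-take-drop t rs x∈ y∈

∉⇒All≢ : ∀ {a} {A : Set a} {n x} {xs : Vec A n} → ¬ (x ∈ᵛ xs) → Vec.All (x ≢_) xs
∉⇒All≢ {xs = []}     _    = Vec.[]
∉⇒All≢ {xs = _ ∷ xs} x∉xs = (x∉xs ∘ here) Vec.∷ ∉⇒All≢ (x∉xs ∘ there)

-- Walks and their shortening to paths.

module _ {n} (G : Graph n) where
  open Graph G

  -- Distance is defined by paths, but joining two paths may repeat vertices. Walks can be joined
  -- and reversed freely, and shorten to paths afterwards.
  data Walk : Fin n → Fin n → ℕ → Set where
    []  : ∀ {u} → Walk u u 0
    _∷_ : ∀ {u w v k} → Adj u w → Walk w v k → Walk u v (suc k)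

  private
    variable
      u v w : Fin n
      j k : ℕ

  infixr 5 _++ʷ_
  _++ʷ_ : Walk u v j → Walk v w k → Walk u w (j + k)
  []      ++ʷ q = q
  (e ∷ p) ++ʷ q = e ∷ (p ++ʷ q)

  reverseʷ : Walk u v k → Walk v u k
  reverseʷ [] = []
  reverseʷ (e ∷ p) = subst (Walk _ _) (+-comm _ 1) (reverseʷ p ++ʷ symm e ∷ [])

  walk-0 : Walk u v 0 → u ≡ v
  walk-0 [] = refl

  path⇒walk : HasPath G u v k → Walk u v k
  path⇒walk (x ∷ [] , refl , refl , _) = []
  path⇒walk (x ∷ y ∷ p , refl , refl , _ ∷ p! , e ∷ es) =
    e ∷ path⇒walk (y ∷ p , refl , refl , p! , es)

  path-from : (p : Vec (Fin n) (suc k)) → IsPath G u v p → w ∈ᵛ p →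
    ∃ λ j → j ≤ k × HasPath G w v j
  path-from p isPath@(refl , _) (here refl) = _ , ≤-refl , p , isPath
  path-from (x ∷ []) _ (there ())
  path-from (x ∷ y ∷ p) (refl , refl , _ ∷ p! , _ ∷ es) (there w∈p) =
    let j , j≤k , q = path-from (y ∷ p) (refl , refl , p! , es) w∈p
    in  j , m≤n⇒m≤1+n j≤k , q

  -- Prepending `u` to a path either keeps the vertices distinct or closes a cycle, which is cut off
  -- by starting at the earlier visit of `u`.
  walk⇒path : Walk u v k → ∃ λ j → j ≤ k × HasPath G u v j
  walk⇒path {u} [] = 0 , z≤n , u ∷ [] , refl , refl , Vec.[] ∷ [] , [-]
  walk⇒path {u} (e ∷ p) with walk⇒path p
  ... | j , j≤k , q , refl , refl , q! , es with mem? _≟_ u q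
  ...   | yes u∈q =
    let i , i≤j , r = path-from q (refl , refl , q! , es) u∈q
    in  i , m≤n⇒m≤1+n (≤-trans i≤j j≤k) , r
  ...   | no u∉q =
    suc j , s≤s j≤k , u ∷ q , refl , refl , ∉⇒All≢ u∉q ∷ q! , e ∷ es

  -- Total on `ℕ`, so that indices carry no bound; beyond the end the value is the final vertex.
  vertex : Walk u v k → ℕ → Fin n
  vertex {u} []      _       = u
  vertex {u} (_ ∷ _) zero    = u
  vertex     (_ ∷ p) (suc i) = vertex p i

  walk-to : (p : Walk u v k) → ∀ {i} → i ≤ k → Walk u (vertex p i) i
  walk-to []      z≤n       = []
  walk-to (_ ∷ _) z≤n       = []
  walk-to (e ∷ p) (s≤s i≤k) = e ∷ walk-to p i≤k

  walk-from : (p : Walk u v k) → ∀ {i} → i ≤ k → Walk (vertex p i) v (k ∸ i)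
  walk-from []      z≤n       = []
  walk-from (e ∷ p) z≤n       = e ∷ p
  walk-from (_ ∷ p) (s≤s i≤k) = walk-from p i≤k

  walk-between : (p : Walk u v k) → ∀ {i j} → i ≤ j → j ≤ k →
    Walk (vertex p i) (vertex p j) (j ∸ i)
  walk-between []      z≤n       z≤n       = []
  walk-between (e ∷ p) z≤n       j≤k       = walk-to (e ∷ p) j≤k
  walk-between (_ ∷ p) (s≤s i≤j) (s≤s j≤k) = walk-between p i≤j j≤k

-- The graph distance as a metric, and its geodesics.

Geodesic : ∀ {n} → DistanceFunction (Fin n) → ℕ → (ℕ → Fin n) → Set
Geodesic d D γ = ∀ {i j} → i ≤ j → j ≤ D → i + d (γ i) (γ j) ≡ j

module _ {n} (G : Graph n) (conn : Connected G) where

  private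
    d : DistanceFunction (Fin n)
    d = dist G conn

  shortest-walk : ∀ u v → Walk G u v (d u v)
  shortest-walk u v =
    path⇒walk G (proj₁ (proj₂ (uncurry (least (hasPath? G u v)) (conn u v))))

  dist≤walk : ∀ {u v k} → Walk G u v k → d u v ≤ k
  dist≤walk {u} {v} p =
    let j , j≤k , q = walk⇒path G p
    in  ≤-trans (proj₂ (proj₂ (uncurry (least (hasPath? G u v)) (conn u v))) j q) j≤k

  dist-isMetric : IsMetric _≡_ d
  dist-isMetric = record
    { isSemiMetric = record
      { isQuasiSemiMetric = record
        { isPreMetric = record
          { isProtoMetric = record
            { isPartialOrder  = ≤-isPartialOrder
            ; ≈-isEquivalence = isEquivalence
            ; cong            = cong₂ d
            ; nonNegative     = z≤n
            }
          ; ≈⇒0 = λ { refl → n≤0⇒n≡0 (dist≤walk []) }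
          }
        ; 0⇒≈ = λ {u} {v} d≡0 → walk-0 G (subst (Walk G u v) d≡0 (shortest-walk u v))
        }
      ; sym = λ u v → ≤-antisym
          (dist≤walk (reverseʷ G (shortest-walk v u)))
          (dist≤walk (reverseʷ G (shortest-walk u v)))
      }
    ; triangle = λ u v w → dist≤walk (_++ʷ_ G (shortest-walk u v) (shortest-walk v w))
    }

  -- The vertices of a shortest walk serve. The additive equation in `Geodesic` says that
  -- `d (γ i) (γ j)` is `j ∸ i` without using truncated subtraction.
  geodesic : ∀ u v → ∃ (Geodesic d (d u v))
  geodesic u v = γ , λ {i} {j} i≤j j≤D → ≤-antisym
    (begin
      i + d (γ i) (γ j)  ≤⟨ +-monoʳ-≤ i (dist≤walk (walk-between G p i≤j j≤D)) ⟩
      i + (j ∸ i)        ≡⟨ m+[n∸m]≡n i≤j ⟩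
      j                  ∎)
    -- Replacing the segment from `γ i` to `γ j` by a shortest walk gives a detour from `u` to `v`,
    -- which cannot beat the distance `d u v`.
    (+-cancelʳ-≤ (d u v ∸ j) j _ (begin
      j + (d u v ∸ j)                          ≡⟨ m+[n∸m]≡n j≤D ⟩
      d u v                                    ≤⟨ dist≤walk (detour i≤j j≤D) ⟩
      i + (d (γ i) (γ j) + (d u v ∸ j))        ≡⟨ +-assoc i _ _ ⟨
      i + d (γ i) (γ j) + (d u v ∸ j)          ∎))
    where
    open ≤-Reasoning
    p : Walk G u v (d u v)
    p = shortest-walk u v
    γ : ℕ → Fin n
    γ = vertex G p
    detour : ∀ {i j} → i ≤ j → j ≤ d u v → Walk G u v (i + (d (γ i) (γ j) + (d u v ∸ j)))
    detour {i} {j} i≤j j≤D =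
      _++ʷ_ G (walk-to G p (≤-trans i≤j j≤D))
        (_++ʷ_ G (shortest-walk (γ i) (γ j)) (walk-from G p j≤D))

-- Lines as subsets.

module _ {n} (d : DistanceFunction (Fin n)) where

  -- The bit of a line at `p` is the outcome of `onLine?`, so equal bit vectors have the same
  -- points.
  line-resp : ∀ {u v u′ v′ p} → line d u v ≡ line d u′ v′ →
    OnLine d u v p → OnLine d u′ v′ p
  line-resp {u} {v} {u′} {v′} {p} eq p∈uv =
    invert (subst (Reflects _) u′v′-at-p (proof (onLine? d u′ v′ p)))
    where
    open ≡-Reasoning
    u′v′-at-p : does (onLine? d u′ v′ p) ≡ true
    u′v′-at-p = begin
      does (onLine? d u′ v′ p)     ≡⟨ Vec.lookup∘tabulate _ p ⟨
      Vec.lookup (line d u′ v′) p  ≡⟨ cong (λ L → Vec.lookup L p) eq ⟨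
      Vec.lookup (line d u v) p    ≡⟨ Vec.lookup∘tabulate _ p ⟩
      does (onLine? d u v p)       ≡⟨ dec-true (onLine? d u v p) p∈uv ⟩
      true                         ∎

  proper-line-misses : ∀ {u v} → line d u v ≢ ⊤ → ∃ λ p → ¬ OnLine d u v p
  proper-line-misses {u} {v} uv≢⊤ = ¬∀⟶∃¬ n (OnLine d u v) (onLine? d u v) λ all-on →
    uv≢⊤ (trans
      (Vec.tabulate-cong λ p → trans (dec-true (onLine? d u v p) (all-on p))
                                     (sym (Vec.lookup-replicate p true)))
      (Vec.tabulate∘lookup ⊤))

  line∈lines : ∀ {u v} → u ≢ v → line d u v ∈ lines d
  line∈lines u≢v =
    ∈-deduplicate⁺ _≟ᴸ_ (∈-map⁺ (uncurry (line d))
      (∈-filter⁺ (λ (u , v) → ¬? (u ≟ v)) (∈-cartesianProduct⁺ (∈-allFin _) (∈-allFin _)) u≢v))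

module _ {n} (d : DistanceFunction (Fin n)) (isMetric : IsMetric _≡_ d) where
  open IsMetric isMetric using (0⇒≈; ≈⇒0; triangle) renaming (sym to d-sym)

  -- Edges of a geodesic that span the same line.

  module _ {D γ} (geo : Geodesic d D γ) where

    Avoids : Fin n → ℕ → Set
    Avoids w i = suc i ≤ D × ¬ OnLine d (γ i) (γ (suc i)) w

    avoids⇒≢ : ∀ {w i} → Avoids w i → w ≢ γ i
    avoids⇒≢ (_ , w∉) w≡γi = w∉ (inj₂ (inj₁ w≡γi))

    geodesic-≢ : ∀ {i j} → i < j → j ≤ D → γ i ≢ γ j
    geodesic-≢ {i} {j} i<j j≤D γi≡γj = <-irrefl (begin-equality
      i                  ≡⟨ +-identityʳ i ⟨
      i + 0              ≡⟨ cong (i +_) (≈⇒0 γi≡γj) ⟨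
      i + d (γ i) (γ j)  ≡⟨ geo (<⇒≤ i<j) j≤D ⟩
      j                  ∎) i<j
      where open ≤-Reasoning

    geodesic-step : ∀ {i} → suc i ≤ D → d (γ i) (γ (suc i)) ≡ 1
    geodesic-step {i} i<D =
      +-cancelˡ-≡ i _ _ (trans (geo (n≤1+n i) i<D) (+-comm 1 i))

    -- Along an edge the distance from `w` changes by at most one. A change of exactly one would
    -- make `w` collinear with the edge, beyond its nearer end.
    equal-distances : ∀ {w i} → Avoids w i → d w (γ i) ≡ d w (γ (suc i))
    equal-distances {w} {i} av@(i<D , w∉) = ≤-antisym
      (≤-pred (≤∧≢⇒< (subst (d w (γ i) ≤_)
          (trans (cong (d w (γ (suc i)) +_) (trans (d-sym _ _) (geodesic-step i<D))) (+-comm _ 1))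
          (triangle w (γ (suc i)) (γ i)))
        λ far → w∉ (inj₂ (inj₂ (inj₂ (inj₂
          ((γi≢ , ≢-sym w≢′ , ≢-sym w≢) ,
           trans (cong₂ _+_ (geodesic-step i<D) (d-sym _ w))
                 (trans (sym far) (d-sym w _)))))))))
      (≤-pred (≤∧≢⇒< (subst (d w (γ (suc i)) ≤_)
          (trans (cong (d w (γ i) +_) (geodesic-step i<D)) (+-comm _ 1))
          (triangle w (γ i) (γ (suc i))))
        λ far → w∉ (inj₁
          ((w≢ , γi≢ , w≢′) ,
           trans (cong (d w (γ i) +_) (geodesic-step i<D)) (trans (+-comm _ 1) (sym far))))))
      where
      γi≢ : γ i ≢ γ (suc i)
      γi≢ = geodesic-≢ ≤-refl i<D
      w≢ : w ≢ γ i
      w≢ = avoids⇒≢ av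
      w≢′ : w ≢ γ (suc i)
      w≢′ w≡ = w∉ (inj₂ (inj₂ (inj₂ (inj₁ w≡))))

    -- The geodesic from γ i to γ j starts with an edge along which the distance from
    -- w is constant, so both triangle inequalities gain one over that edge.
    shortcut : ∀ {w i j} → i < j → j ≤ D → Avoids w i →
      d w (γ i) < d w (γ j) + d (γ i) (γ j) × d w (γ j) < d w (γ i) + d (γ i) (γ j)
    shortcut {w} {i} {j} i<j j≤D av =
      subst₂ (λ x y → x < d w (γ j) + y) (sym flat) (sym step)
        (subst (d w (γ (suc i)) <_) (sym (+-suc _ _))
          (s≤s (subst (λ x → d w (γ (suc i)) ≤ d w (γ j) + x) (d-sym _ _)
            (triangle w (γ j) (γ (suc i)))))) ,
      subst₂ (λ x y → d w (γ j) < x + y) (sym flat) (sym step)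
        (subst (d w (γ j) <_) (sym (+-suc _ _)) (s≤s (triangle w (γ (suc i)) (γ j))))
      where
      flat : d w (γ i) ≡ d w (γ (suc i))
      flat = equal-distances av
      step : d (γ i) (γ j) ≡ suc (d (γ (suc i)) (γ j))
      step = +-cancelˡ-≡ i _ _
        (trans (geo (<⇒≤ i<j) j≤D) (sym (trans (+-suc i _) (geo i<j j≤D))))

    -- The point `γ j` lies on its own line with `w`, hence on the line of `w` and `γ i`. Of the
    -- three collinear orders, `shortcut` excludes those with `γ j` or `γ i` in the middle, which
    -- leaves `w`.
    between : ∀ {w i j} → i < j → j ≤ D → Avoids w i → w ≢ γ j →
      line d w (γ i) ≡ line d w (γ j) →
      d w (γ i) + d w (γ j) ≡ d (γ i) (γ j)
    between {w} {i} {j} i<j j≤D av w≢γj eq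
      with line-resp d {p = γ j} (sym eq) (inj₂ (inj₂ (inj₂ (inj₁ refl))))
    ... | inj₁ (_ , e) =
      trans (+-comm (d w (γ i)) _) (trans (cong (_+ d w (γ i)) (d-sym w _)) (trans e (d-sym _ _)))
    ... | inj₂ (inj₁ γj≡w) = contradiction (sym γj≡w) w≢γj
    ... | inj₂ (inj₂ (inj₁ (_ , e))) =
      contradiction (trans (sym e) (cong (d w (γ j) +_) (d-sym _ _)))
        (<⇒≢ (proj₁ (shortcut i<j j≤D av)))
    ... | inj₂ (inj₂ (inj₂ (inj₁ γj≡γi))) = contradiction (sym γj≡γi) (geodesic-≢ i<j j≤D)
    ... | inj₂ (inj₂ (inj₂ (inj₂ (_ , e)))) =
      contradiction (sym e) (<⇒≢ (proj₂ (shortcut i<j j≤D av)))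

    -- With `a`, `b`, `c` the distances from `w`, two uses of `between` give
    -- `(a + b) + (b + c) = k ∸ i`, while the triangle inequality through `w` bounds `k ∸ i` by
    -- `a + c`. So `b = 0` and `w` would be `γ j`.
    no-three-avoided : ∀ {w i j k} → i < j → j < k → Avoids w i → Avoids w j → Avoids w k →
      line d w (γ i) ≡ line d w (γ j) → line d w (γ j) ≡ line d w (γ k) → ⊥
    no-three-avoided {w} {i} {j} {k} i<j j<k avᵢ avⱼ avₖ ij jk =
      avoids⇒≢ avⱼ (0⇒≈ (m+n≡0⇒m≡0 b (n≤0⇒n≡0 (+-cancelˡ-≤ (i + (a + c)) (b + b) 0 (begin
        i + (a + c) + (b + b)
          ≡⟨ solve 4 (λ i a b c → i :+ (a :+ c) :+ (b :+ b) := i :+ (a :+ b) :+ (b :+ c))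
               refl i a b c ⟩
        i + (a + b) + (b + c)
          ≡⟨ cong₂ (λ x y → i + x + y) (between i<j j≤D avᵢ (avoids⇒≢ avⱼ) ij)
                                       (between j<k k≤D avⱼ (avoids⇒≢ avₖ) jk) ⟩
        i + d (γ i) (γ j) + d (γ j) (γ k)
          ≡⟨ cong (_+ d (γ j) (γ k)) (geo (<⇒≤ i<j) j≤D) ⟩
        j + d (γ j) (γ k)
          ≡⟨ geo (<⇒≤ j<k) k≤D ⟩
        k
          ≡⟨ geo (<⇒≤ (<-trans i<j j<k)) k≤D ⟨
        i + d (γ i) (γ k)
          ≤⟨ +-monoʳ-≤ i (triangle (γ i) w (γ k)) ⟩
        i + (d (γ i) w + c)
          ≡⟨ cong (λ x → i + (x + c)) (d-sym (γ i) w) ⟩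
        i + (a + c)
          ≡⟨ +-identityʳ _ ⟨
        i + (a + c) + 0
          ∎)))))
      where
      open ≤-Reasoning
      a b c : ℕ
      a = d w (γ i)
      b = d w (γ j)
      c = d w (γ k)
      j≤D : j ≤ D
      j≤D = ≤-trans (n≤1+n j) (proj₁ avⱼ)
      k≤D : k ≤ D
      k≤D = ≤-trans (n≤1+n k) (proj₁ avₖ)

    -- Two nested pigeonholes: edges are sorted by the line they span, and edges with a common line
    -- by the line joining their start to a point `w` off it. Each final class has at most two
    -- edges.
    geodesic-length≤ : NoUniversalLine d → D ≤ numberOfLines d * (numberOfLines d * 2)
    geodesic-length≤ no-universal = subst (_≤ _) (length-upTo D)
      (length≤∑fibres _≟ᴸ_ edge-line (lines d) (upTo D)
        (All.map (λ i<D → line∈lines d (geodesic-≢ ≤-refl i<D)) (All.all-upTo D))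
        λ L → edges-sharing-line≤ L (fibre _≟ᴸ_ edge-line L (upTo D))
          (AllPairs.filter⁺ (λ i → edge-line i ≟ᴸ L) (AllPairs.applyUpTo⁺₁ id D λ i<j _ → i<j))
          λ i∈ → let i∈upTo , eq = ∈-filter⁻ (λ i → edge-line i ≟ᴸ L) i∈ in ∈-upTo⁻ i∈upTo , eq)
      where
      edge-line : ℕ → Subset n
      edge-line i = line d (γ i) (γ (suc i))
      edges-sharing-line≤ : ∀ L E → AllPairs _<_ E → (∀ {i} → i ∈ E → i < D × edge-line i ≡ L) →
        length E ≤ numberOfLines d * 2
      edges-sharing-line≤ _ []        _  _   = z≤n
      edges-sharing-line≤ L E@(_ ∷ _) E↗ E-L
        -- The first edge identifies `L` as a line spanned by two distinct points, so that some `w`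
        -- is off it.
        with i<D , refl ← E-L (here refl)
        with w , w∉L ← proper-line-misses d (no-universal _ _ (geodesic-≢ ≤-refl i<D)) =
        length≤∑fibres _≟ᴸ_ spoke (lines d) E
          (All.tabulate λ i∈E → line∈lines d (avoids⇒≢ (avoids i∈E)))
          λ c → no-triple⇒length≤2 (fibre _≟ᴸ_ spoke c E)
            (AllPairs.filter⁺ (λ i → spoke i ≟ᴸ c) E↗)
            λ i∈ j∈ k∈ i<j j<k →
              let i∈E , ic = ∈-filter⁻ (λ i → spoke i ≟ᴸ c) i∈
                  j∈E , jc = ∈-filter⁻ (λ i → spoke i ≟ᴸ c) j∈
                  k∈E , kc = ∈-filter⁻ (λ i → spoke i ≟ᴸ c) k∈
              in  no-three-avoided i<j j<k (avoids i∈E) (avoids j∈E) (avoids k∈E)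
                    (trans ic (sym jc)) (trans jc (sym kc))
        where
        spoke : ℕ → Subset n
        spoke i = line d w (γ i)
        avoids : ∀ {i} → i ∈ E → Avoids w i
        avoids i∈E = let i<D , eq = E-L i∈E in i<D , w∉L ∘ line-resp d eq

  -- Points on a common line through `x`, at a common distance.

  module _ {x : Fin n} {L : Subset n} {r : ℕ} where

    InClass : Fin n → Set
    InClass y = x ≢ y × line d x y ≡ L × d x y ≡ r

    r≢0 : ∀ {y} → InClass y → r ≢ 0
    r≢0 (x≢y , _ , refl) r≡0 = x≢y (0⇒≈ r≡0)

    -- Equality of lines puts `z` on the line of `x` and `y`. If `y` or `z` were in the middle,
    -- equal distances from `x` would force `d y z = 0`; so `x` is in the middle.
    equidistant : ∀ {y z} → InClass y → InClass z → y ≢ z → d y z ≡ r + r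
    equidistant {y} {z} y∈@(x≢y , xyL , xy) (x≢z , xzL , xz) y≢z
      with line-resp d {p = z} (trans xzL (sym xyL)) (inj₂ (inj₂ (inj₂ (inj₁ refl))))
    ... | inj₁ (_ , e) = trans (d-sym y z)
      (trans (sym e) (cong₂ _+_ (trans (d-sym z x) xz) xy))
    ... | inj₂ (inj₁ z≡x) = contradiction (sym z≡x) x≢z
    ... | inj₂ (inj₂ (inj₁ (_ , e))) = contradiction
      (sym (0⇒≈ (m+n≡m⇒n≡0 r (trans (cong (_+ d z y) (sym xz)) (trans e xy))))) y≢z
    ... | inj₂ (inj₂ (inj₂ (inj₁ z≡y))) = contradiction (sym z≡y) y≢z
    ... | inj₂ (inj₂ (inj₂ (inj₂ (_ , e)))) = contradiction
      (0⇒≈ (m+n≡m⇒n≡0 r (trans (cong (_+ d y z) (sym xy)) (trans e xz)))) y≢z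

    -- All three distances are `r + r`, so collinearity would force `r = 0`.
    not-between : ∀ {a b c} → InClass a → InClass b → InClass c → ¬ Between d a b c
    not-between a∈ b∈ c∈ ((a≢b , b≢c , a≢c) , e) =
      r≢0 a∈ (m+n≡0⇒m≡0 r (m+n≡m⇒n≡0 (r + r) (trans
        (cong₂ _+_ (sym (equidistant a∈ b∈ a≢b)) (sym (equidistant b∈ c∈ b≢c)))
        (trans e (equidistant a∈ c∈ a≢c)))))

    class-on-line : ∀ {a b c} → InClass a → InClass b → InClass c →
      OnLine d a b c → c ≡ a ⊎ c ≡ b
    class-on-line a∈ b∈ c∈ (inj₁ cab)                      = contradiction cab (not-between c∈ a∈ b∈)
    class-on-line a∈ b∈ c∈ (inj₂ (inj₁ c≡a))               = inj₁ c≡a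
    class-on-line a∈ b∈ c∈ (inj₂ (inj₂ (inj₁ acb)))        = contradiction acb (not-between a∈ c∈ b∈)
    class-on-line a∈ b∈ c∈ (inj₂ (inj₂ (inj₂ (inj₁ c≡b)))) = inj₂ c≡b
    class-on-line a∈ b∈ c∈ (inj₂ (inj₂ (inj₂ (inj₂ abc)))) = contradiction abc (not-between a∈ b∈ c∈)

    class-size : ∀ {S} t → List.Unique S → (∀ {y} → y ∈ S → InClass y) →
      t + t ≤ length S → t * t ≤ numberOfLines d
    class-size {S} t S! S-class 2t≤|S| = begin
      t * t                          ≤⟨ *-mono-≤ t≤|A| t≤|B| ⟩
      length A * length B            ≡⟨ length-cartesianProduct A B ⟨
      length (cartesianProduct A B)  ≤⟨ injective⇒length≤ _≟ᴸ_ (uncurry (line d)) (lines d)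
        (Unique.cartesianProduct⁺ (Unique.take⁺ t S!) (Unique.drop⁺ t S!))
        (All.tabulate λ ab∈ → let a∈ , b∈ = ∈-cartesianProduct⁻ A B ab∈
                              in  line∈lines d (A≢B a∈ b∈))
        (λ p∈ q∈ → line-injective (∈-cartesianProduct⁻ A B p∈) (∈-cartesianProduct⁻ A B q∈)) ⟩
      numberOfLines d                ∎
      where
      open ≤-Reasoning
      A B : List (Fin n)
      A = take t S
      B = drop t S
      t≤|A| : t ≤ length A
      t≤|A| = ≤-reflexive (sym (trans (length-take t S) (m≤n⇒m⊓n≡m (≤-trans (m≤m+n t t) 2t≤|S|))))
      t≤|B| : t ≤ length B
      t≤|B| = subst (t ≤_) (sym (length-drop t S)) (m+n≤o⇒m≤o∸n t 2t≤|S|)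
      A≢B : ∀ {a b} → a ∈ A → b ∈ B → a ≢ b
      A≢B = AllPairs-take-drop t S!
      A-class : ∀ {a} → a ∈ A → InClass a
      A-class = All.lookup (All.take⁺ t (All.tabulate S-class))
      B-class : ∀ {b} → b ∈ B → InClass b
      B-class = All.lookup (All.drop⁺ t (All.tabulate S-class))
      -- The only class points on the line of `a` and `b` are these two, and disjointness of `A` and
      -- `B` tells which is which.
      line-injective : ∀ {a b a′ b′} → a ∈ A × b ∈ B → a′ ∈ A × b′ ∈ B →
        line d a b ≡ line d a′ b′ → (a , b) ≡ (a′ , b′)
      line-injective (a∈ , b∈) (a′∈ , b′∈) eq = cong₂ _,_
        ([ id , (λ a≡b′ → contradiction a≡b′ (A≢B a∈ b′∈)) ]′
          (class-on-line (A-class a′∈) (B-class b′∈) (A-class a∈)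
            (line-resp d eq (inj₂ (inj₁ refl)))))
        ([ (λ b≡a′ → contradiction (sym b≡a′) (A≢B a′∈ b∈)) , id ]′
          (class-on-line (A-class a′∈) (B-class b′∈) (B-class b∈)
            (line-resp d eq (inj₂ (inj₂ (inj₂ (inj₁ refl)))))))

  -- Counting all points as seen from `x`.

  points≤ : ∀ {D s} x ys → List.Unique ys → All (x ≢_) ys → (∀ y → d x y ≤ D) →
    numberOfLines d < suc s * suc s →
    length ys ≤ numberOfLines d * (suc D * suc (s + s))
  points≤ {D} {s} x ys ys! x≢ys d≤D m<[1+s]² =
    length≤∑fibres _≟ᴸ_ (line d x) (lines d) ys (All.map (line∈lines d) x≢ys) λ L →
      -- Within one line the points are sorted by distance from `x`; the values `0` to `D` give the
      -- factor `suc D`.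
      subst (λ k → length (same-line L) ≤ k * suc (s + s)) (length-upTo (suc D))
        (length≤∑fibres ℕ._≟_ (d x) (upTo (suc D)) (same-line L)
          (All.tabulate λ _ → ∈-upTo⁺ (s≤s (d≤D _))) (class≤ L))
    where
    same-line : Subset n → List (Fin n)
    same-line L = fibre _≟ᴸ_ (line d x) L ys
    class≤ : ∀ L r → length (fibre ℕ._≟_ (d x) r (same-line L)) ≤ suc (s + s)
    -- More than `2s + 1` points means at least `2(s + 1)`, and `class-size` would then give
    -- `(s + 1)²` lines, exceeding their number.
    class≤ L r = ≮⇒≥ λ 2s+1<|S| → <⇒≱ m<[1+s]²
      (class-size {x} {L} {r} (suc s)
        (Unique.filter⁺ (λ y → d x y ℕ.≟ r) (Unique.filter⁺ (λ y → line d x y ≟ᴸ L) ys!))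
        (λ y∈ → let y∈′ , xy = ∈-filter⁻ (λ y → d x y ℕ.≟ r) y∈
                    y∈ys , xyL = ∈-filter⁻ (λ y → line d x y ≟ᴸ L) y∈′
                in  All.lookup x≢ys y∈ys , xyL , xy)
        (≤-trans (≤-reflexive (cong suc (+-suc s s))) 2s+1<|S|))

-- Arithmetic of the final bound.

integer-sqrt : ∀ m → ∃ λ s → s * s ≤ m × m < suc s * suc s
integer-sqrt zero = 0 , z≤n , s≤s z≤n
integer-sqrt (suc m) with integer-sqrt m
... | s , s²≤m , m<[1+s]² with m≤n⇒m<n∨m≡n m<[1+s]²
...   | inj₁ 1+m<[1+s]² = s , m≤n⇒m≤1+n s²≤m , 1+m<[1+s]²
...   | inj₂ 1+m≡[1+s]² = suc s , ≤-reflexive (sym 1+m≡[1+s]²) ,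
  subst (_< suc (suc s) * suc (suc s)) (sym 1+m≡[1+s]²) (*-mono-< (n<1+n (suc s)) (n<1+n (suc s)))

n≤10sm³ : ∀ {s m} → 1 ≤ s → 1 ≤ m →
  suc (m * (suc (m * (m * 2)) * suc (s + s))) ≤ 10 * (s * m ^ 3)
n≤10sm³ {s} {m} 1≤s 1≤m = begin
  1 + m * ((1 + m * (m * 2)) * (1 + (s + s)))
    -- Each summand `1` is raised to the degree of its neighbours: to `s * m ^ 3`, `m * m` and `s`
    -- in turn. The total is then `1 + 3 * 3` copies of `s * m ^ 3`.
    ≤⟨ +-mono-≤ (*-mono-≤ 1≤s (^-monoˡ-≤ 3 1≤m))
         (*-monoʳ-≤ m (*-mono-≤ (+-monoˡ-≤ (m * (m * 2)) (*-mono-≤ 1≤m 1≤m)) (+-monoˡ-≤ (s + s) 1≤s))) ⟩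
  s * m ^ 3 + m * ((m * m + m * (m * 2)) * (s + (s + s)))
    ≡⟨ solve 2 (λ s m → s :* m :^ 3 :+ m :* ((m :* m :+ m :* (m :* con 2)) :* (s :+ (s :+ s)))
                     := con 10 :* (s :* m :^ 3)) refl s m ⟩
  10 * (s * m ^ 3)
    ∎
  where open ≤-Reasoning

n²≤2⁸m⁷ : ∀ {n s m} → s * s ≤ m → n ≤ 10 * (s * m ^ 3) → n ^ 2 ≤ 2 ^ 8 * m ^ 7
n²≤2⁸m⁷ {n} {s} {m} s²≤m n≤ = begin
  n ^ 2                           ≤⟨ ^-monoˡ-≤ 2 n≤ ⟩
  (10 * (s * m ^ 3)) ^ 2          ≡⟨ square 10 s m ⟩
  -- Here `100 + 156` is `2 ^ 8`, and `s * s ≤ m` supplies the seventh factor `m`.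
  10 * 10 * (s * s * m ^ 6)       ≤⟨ *-mono-≤ (m≤m+n 100 156) (*-monoˡ-≤ (m ^ 6) s²≤m) ⟩
  2 ^ 8 * m ^ 7                   ∎
  where
  open ≤-Reasoning
  square : ∀ c s m → (c * (s * m ^ 3)) ^ 2 ≡ c * c * (s * s * m ^ 6)
  square = solve 3 (λ c s m →
    (c :* (s :* m :^ 3)) :^ 2 := c :* c :* (s :* s :* m :^ 6)) refl

counting-bound : ∀ {n m} → 2 ≤ n →
  (∀ s → m < suc s * suc s → n ≤ suc (m * (suc (m * (m * 2)) * suc (s + s)))) →
  n ^ 2 ≤ 2 ^ 8 * m ^ 7
counting-bound {n} {m} 2≤n n≤ =
  n²≤2⁸m⁷ {s = s} s²≤m (≤-trans (n≤ s m<[1+s]²) (n≤10sm³ 1≤s 1≤m))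
  where
  s : ℕ
  s = proj₁ (integer-sqrt m)
  s²≤m : s * s ≤ m
  s²≤m = proj₁ (proj₂ (integer-sqrt m))
  m<[1+s]² : m < suc s * suc s
  m<[1+s]² = proj₂ (proj₂ (integer-sqrt m))
  1≤m : 1 ≤ m
  -- For `m = 0` the assumed bound at `s = 0` reads `n ≤ 1`.
  1≤m = n≢0⇒n>0 λ { refl → contradiction (≤-trans 2≤n (n≤ 0 (s≤s z≤n))) (<-irrefl refl) }
  1≤s : 1 ≤ s
  1≤s = n≢0⇒n>0 λ s≡0 → <⇒≱ (subst (λ s → m < suc s * suc s) s≡0 m<[1+s]²) 1≤m

-- The bound for connected graphs.

all-but : ∀ {n} (x : Fin n) →
  ∃ λ ys → List.Unique ys × All (x ≢_) ys × suc (length ys) ≡ n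
all-but {suc n} x =
  tabulate (punchIn x) , Unique.tabulate⁺ (punchIn-injective x _ _) ,
  All.tabulate⁺ (λ y → ≢-sym (punchInᵢ≢i x y)) , cong suc (length-tabulate (punchIn x))

-- The conclusion is the seventh power of the stated bound, cleared of the negative exponent. The
-- case `n = 1` is excluded: there are no lines then, and the inequality would read `1 ≤ 0`.
corollary1 : (n : ℕ) → 2 ≤ n → (G : Graph n) (conn : Connected G) →
    NoUniversalLine (dist G conn) →
    n ^ 2 ≤ 2 ^ 8 * numberOfLines (dist G conn) ^ 7
corollary1 n 2≤n G conn no-universal = counting-bound 2≤n λ s m<[1+s]² →
  let ys , ys! , x≢ys , 1+|ys|≡n = all-but x
  in  ≤-trans (≤-reflexive (sym 1+|ys|≡n))
        (s≤s (points≤ (dist G conn) isMetric {s = s} x ys ys! x≢ys distance≤ m<[1+s]²))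
  where
  isMetric : IsMetric _≡_ (dist G conn)
  isMetric = dist-isMetric G conn
  x : Fin n
  x = fromℕ< (<⇒≤ 2≤n)
  distance≤ : ∀ y → dist G conn x y ≤
    numberOfLines (dist G conn) * (numberOfLines (dist G conn) * 2)
  distance≤ y = geodesic-length≤ (dist G conn) isMetric (proj₂ (geodesic G conn x y)) no-universal
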